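{- Let $p(\overline{x_n})$ be a polynomial with integer coefficients in the unknowns $x_1,\ldots,x_n$, let $F$ be a function variable of arity $n$, let $s=\mathrm{cvt}[F,p(\overline{x_n})]^+$ and $t=\mathrm{cvt}[F,p(\overline{x_n})]^-$, and let $(\{s\stackrel{?}{=}_F t\},\mathcal{A},F)$ be the ASOGU problem induced by $p(\overline{x_n})$. Then there exist non-negative integers $h_1,\ldots,h_n\geq 0$ such that $$\sigma=\bigl\{F\mapsto\lambda x_1\ldots x_n.\,g(\overbrace{x_1,\ldots,x_1}^{h_1},\ldots,\overbrace{x_n,\ldots,x_n}^{h_n})\bigr\}$$ is a unifier of $\{s\stackrel{?}{=}_F t\}$ if and only if $\{x_i\mapsto h_i\mid 1\leq i\leq n\}$ is a solution to $p(\overline{x_n})=0$.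
   Context: The signature $\Sigma$ is finite and contains a binary symbol $g$ and a constant $a$; $\mathcal{A}=\{g(x,g(y,z))=g(g(x,y),z)\}$, and $\approx_{\mathcal{A}}$ is the equational theory induced by $\mathcal{A}$. Terms are written in flattened form: $g(u_1,\ldots,u_m)$ stands for a nested application of $g$ to $u_1,\ldots,u_m$ in this order, intermediate occurrences of $g$ being dropped. $a^k$ stands for a sequence of $k$ copies of $a$. $\overline{x_n}$ abbreviates $x_1,\ldots,x_n$. A function variable has arity $>0$; $F$ of arity $n$ is applied to $n$ argument terms. For $\sigma=\{F\mapsto\lambda x_1\ldots x_n.r\}$, $u\sigma$ is taken in $\beta$-normal form: $F(u_1,\ldots,u_n)\sigma$ is the result of simultaneously replacing each $x_i$ in $r$ by $u_i\sigma$, and $f(u_1,\ldots,u_l)\sigma=f(u_1\sigma,\ldots,u_l\sigma)$ for $f\in\Sigma$. Such a $\sigma$ is a unifier of $\{s\stackrel{?}{=}_F t\}$ (as part of the problem with theory $\mathcal{A}$) if $s\sigma\approx_{\mathcal{A}}t\sigma$. Monomial groupings. Polynomials are in reduced form (multiplication fully distributed over addition, like terms combined), have integer coefficients, and their unknowns range over the natural numbers (with $0$). For each polynomial $p(\overline{x_n})$ a total linear order $<_p$ on $x_1,\ldots,x_n$ is fixed. $p_0\in\mathbb{Z}$ denotes the constant term of $p$. For $1\leq j\leq n$, $p_{x_j}$ is the sum of those monomials of $p$ that are divisible by $x_j$ and not divisible by any $x_i$ with $x_i<_p x_j$ (and $p_{x_j}=0$ if there are none). Writing $p_{x_j}=x_j\cdot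 p'$, the reduction is $p_{x_j}\!\downarrow\;=p'$. $n$-converter. The terms $\mathrm{cvt}[F,p]^+$ and $\mathrm{cvt}[F,p]^-$ are defined recursively. If $p=c$ is constant: $\mathrm{cvt}[F,p]^+=g(a^{c+1})$ if $c\geq 1$ and $\mathrm{cvt}[F,p]^+=a$ if $c\leq 0$; $\mathrm{cvt}[F,p]^-=g(a^{|c|+1})$ if $c<0$ and $\mathrm{cvt}[F,p]^-=a$ if $c\geq 0$. If $p\neq p_0$, put $c=p_0$ and, for $\star\in\{+,-\}$ and $1\leq i\leq n$, $t_i^\star=\mathrm{cvt}[F,p_{x_i}\!\downarrow]^\star$; then $\mathrm{cvt}[F,p]^+=g(a^{c},F(t_1^+,\ldots,t_n^+))$ if $c\geq 1$ and $\mathrm{cvt}[F,p]^+=F(t_1^+,\ldots,t_n^+)$ if $c\leq 0$; $\mathrm{cvt}[F,p]^-=g(a^{|c|},F(t_1^-,\ldots,t_n^-))$ if $c<0$ and $\mathrm{cvt}[F,p]^-=F(t_1^-,\ldots,t_n^-)$ if $c\geq 0$. The ASOGU (associative second-order ground unification) problem induced by $p$ is the triple consisting of the single unification equation between $\mathrm{cvt}[F,p]^-$ and $\mathrm{cvt}[F,p]^+$, the theory $\mathcal{A}$, and $F$. -}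

module Defs where

open import Data.Empty using (⊥)
open import Data.Fin.Base using (Fin; zero; suc)
open import Data.Fin.Properties using (all?)
open import Data.Integer.Base as ℤ using (ℤ; +_; -[1+_]; 0ℤ)
open import Data.List.Base using (List; []; _∷_; [_]; replicate; concatMap; allFin; filter; map; foldr)
open import Data.List.Extrema.Nat using (max; max<v⁺; xs≤max)
open import Data.List.NonEmpty.Base using (List⁺; foldr₁; _∷ʳ_; fromList)
open import Data.List.Membership.Propositional using (_∈_)
open import Data.List.Relation.Unary.All as All using (All; []; _∷_)
import Data.List.Relation.Unary.All.Properties as All
open import Data.List.Relation.Unary.AllPairs using (AllPairs; []; _∷_)
import Data.List.Relation.Unary.AllPairs.Properties as AllPairs
open import Data.Maybe.Base using (maybe′)
open import Data.Nat.Base as ℕ using (ℕ; zero; suc; pred; _≤_; _<_)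
import Data.Nat.Properties as ℕ
open import Data.Nat.Induction using (<-wellFounded)
open import Data.Product.Base using (Σ-syntax; ∃; _×_; _,_; proj₁)
open import Data.Sign.Base using (Sign)
open import Data.Vec.Base as Vec using (Vec; []; _∷_; lookup; tabulate; updateAt; zipWith)
import Data.Vec.Properties as Vec
open import Data.Vec.Relation.Binary.Pointwise.Inductive using (Pointwise)
open import Function.Base using (_∘_; _on_)
open import Function.Bundles using (_↔_)
open import Induction.WellFounded using (Acc; acc)
open import Level using (0ℓ)
open import Relation.Binary.Core using (Rel)
open import Relation.Binary.PropositionalEquality using (_≡_; _≢_; refl; cong; cong₂)
open import Relation.Binary.Structures using (IsStrictTotalOrder)
open import Relation.Nullary using (¬_; Dec; yes; no; ¬?; _×-dec_; _→-dec_)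

------------------------------------------------------------------------
-- Terms

-- `Sym k` is the set of symbols of arity k.
record Signature : Set₁ where
  field
    Sym    : ℕ → Set
    finite : Σ[ k ∈ ℕ ] (∃ Sym ↔ Fin k)
    g      : Sym 2
    a      : Sym 0

data Term (Op : ℕ → Set) (X : Set) : Set where
  var : X → Term Op X
  app : ∀ {k} → Op k → Vec (Term Op X) k → Term Op X

module _ {Op : ℕ → Set} {X Y : Set} (θ : X → Term Op Y) where

  mutual
    subst : Term Op X → Term Op Y
    subst (var x)    = θ x
    subst (app f us) = app f (substs us)

    substs : ∀ {k} → Vec (Term Op X) k → Vec (Term Op Y) k
    substs []       = []
    substs (u ∷ us) = subst u ∷ substs us

-- Σ extended with the function variable F of arity n.
data WithF (Op : ℕ → Set) (n : ℕ) : ℕ → Set where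
  sym : ∀ {k} → Op k → WithF Op n k
  F   : WithF Op n n

-- Flattened g(u₁,…,uₘ) for m ≥ 1, nested to the right; g(u) is u.
flat : ∀ {Op X} → Op 2 → List⁺ (Term Op X) → Term Op X
flat g = foldr₁ (λ u v → app g (u ∷ v ∷ []))

------------------------------------------------------------------------
-- Equational theories

Equation : (ℕ → Set) → Set → Set
Equation Op X = Term Op X × Term Op X

data _⊢_≈_ {Op : ℕ → Set} {X : Set} (E : List (Equation Op ℕ)) : Rel (Term Op X) 0ℓ where
  ax      : ∀ {l r} → (l , r) ∈ E → (θ : ℕ → Term Op X) → E ⊢ subst θ l ≈ subst θ r
  ≈-refl  : ∀ {u} → E ⊢ u ≈ u
  ≈-sym   : ∀ {u v} → E ⊢ u ≈ v → E ⊢ v ≈ u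
  ≈-trans : ∀ {u v w} → E ⊢ u ≈ v → E ⊢ v ≈ w → E ⊢ u ≈ w
  ≈-cong  : ∀ {k} (f : Op k) {us vs} → Pointwise (E ⊢_≈_) us vs → E ⊢ app f us ≈ app f vs

𝒜 : (S : Signature) → List (Equation (Signature.Sym S) ℕ)
𝒜 S = [ G x (G y z) , G (G x y) z ]
  where
  open Signature S
  G : Term Sym ℕ → Term Sym ℕ → Term Sym ℕ
  G u v = app g (u ∷ v ∷ [])
  x y z : Term Sym ℕ
  x = var 0
  y = var 1
  z = var 2

------------------------------------------------------------------------
-- Second-order ground unification

-- The equations contain no first-order variables, and F, of arity n, is the
-- only function variable.
record Problem (S : Signature) (n : ℕ) : Set where
  open Signature S
  field
    equations : List (Equation (WithF Sym n) ⊥)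
    theory    : List (Equation Sym ℕ)

-- The body r of F ↦ λ x₁ … xₙ. r; `var i` is the bound variable xᵢ.
Body : Signature → ℕ → Set
Body S n = Term (Signature.Sym S) (Fin n)

module _ {S : Signature} {n : ℕ} (r : Body S n) where
  open Signature S

  mutual
    _[F≔] : Term (WithF Sym n) ⊥ → Term Sym ⊥
    app (sym f) us [F≔] = app f (us [F≔]*)
    app F       us [F≔] = subst (lookup (us [F≔]*)) r

    _[F≔]* : ∀ {k} → Vec (Term (WithF Sym n) ⊥) k → Vec (Term Sym ⊥) k
    []       [F≔]* = []
    (u ∷ us) [F≔]* = u [F≔] ∷ us [F≔]*

  IsUnifier : Problem S n → Set
  IsUnifier P = All (λ (s , t) → Problem.theory P ⊢ s [F≔] ≈ (t [F≔])) (Problem.equations P)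

-- g(x₁,…,x₁,…,xₙ,…,xₙ) with lookup h i copies of xᵢ.  If h is zero everywhere
-- then g has no arguments, and this is not a term: 𝒜 has no unit.  The body is
-- then taken to be the ground term e.
repeatBody : (S : Signature) {n : ℕ} → Term (Signature.Sym S) ⊥ → Vec ℕ n → Body S n
repeatBody S {n} e h =
  maybe′ (flat g) (subst (λ ()) e)
    (fromList (concatMap (λ i → replicate (lookup h i) (var i)) (allFin n)))
  where open Signature S

------------------------------------------------------------------------
-- Polynomials in reduced form

record Monomial (n : ℕ) : Set where
  field
    coeff     : ℤ
    nonzero   : coeff ≢ 0ℤ
    exponents : Vec ℕ n
open Monomial public

record Polynomial (n : ℕ) : Set where
  field
    monomials : List (Monomial n)
    distinct  : AllPairs (_≢_ on exponents) monomials
open Polynomial public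

sumℤ : List ℤ → ℤ
sumℤ = foldr ℤ._+_ 0ℤ

value : ∀ {n} → Vec ℕ n → Monomial n → ℤ
value h m = coeff m ℤ.* + Vec.foldr _ ℕ._*_ 1 (zipWith ℕ._^_ h (exponents m))

⟦_⟧ : ∀ {n} → Polynomial n → Vec ℕ n → ℤ
⟦ p ⟧ h = sumℤ (map (value h) (monomials p))

IsConstant : ∀ {n} → Monomial n → Set
IsConstant m = exponents m ≡ Vec.replicate _ 0

isConstant? : ∀ {n} (m : Monomial n) → Dec (IsConstant m)
isConstant? m = Vec.≡-dec ℕ._≟_ _ _

-- At most one monomial survives the filter.
constantTerm : ∀ {n} → Polynomial n → ℤ
constantTerm p = sumℤ (map coeff (filter isConstant? (monomials p)))

Constant : ∀ {n} → Polynomial n → Set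
Constant p = All IsConstant (monomials p)

constant? : ∀ {n} (p : Polynomial n) → Dec (Constant p)
constant? p = All.all? isConstant? (monomials p)

_∣ᵐ_ : ∀ {n} → Fin n → Monomial n → Set
j ∣ᵐ m = 1 ≤ lookup (exponents m) j

_∣ᵐ?_ : ∀ {n} (j : Fin n) (m : Monomial n) → Dec (j ∣ᵐ m)
j ∣ᵐ? m = 1 ℕ.≤? lookup (exponents m) j

------------------------------------------------------------------------
-- Monomial groupings

record VariableOrder (n : ℕ) : Set₁ where
  field
    _≺_                : Rel (Fin n) 0ℓ
    isStrictTotalOrder : IsStrictTotalOrder _≡_ _≺_
  open IsStrictTotalOrder isStrictTotalOrder public using () renaming (_<?_ to _≺?_)

module _ {n : ℕ} (o : VariableOrder n) where
  open VariableOrder o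

  InGroup : Fin n → Monomial n → Set
  InGroup j m = j ∣ᵐ m × (∀ i → i ≺ j → ¬ i ∣ᵐ m)

  inGroup? : ∀ j m → Dec (InGroup j m)
  inGroup? j m = (j ∣ᵐ? m) ×-dec all? (λ i → (i ≺? j) →-dec ¬? (i ∣ᵐ? m))

  group : Polynomial n → Fin n → Polynomial n
  group p j = record
    { monomials = filter (inGroup? j) (monomials p)
    ; distinct  = AllPairs.filter⁺ (inGroup? j) (distinct p)
    }

  group-divisible : ∀ p j → All (j ∣ᵐ_) (monomials (group p j))
  group-divisible p j = All.map proj₁ (All.all-filter (inGroup? j) (monomials p))

divideMonomial : ∀ {n} → Fin n → Monomial n → Monomial n
divideMonomial j m = record
  { coeff     = coeff m
  ; nonzero   = nonzero m
  ; exponents = updateAt (exponents m) j pred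
  }

private
  pred-injective : ∀ {n} (j : Fin n) (es ds : Vec ℕ n) → 1 ≤ lookup es j → 1 ≤ lookup ds j →
                   updateAt es j pred ≡ updateAt ds j pred → es ≡ ds
  pred-injective zero    (suc e ∷ es) (suc d ∷ ds) _ _ refl = refl
  pred-injective (suc j) (e ∷ es)     (d ∷ ds)     p q eq   =
    cong₂ _∷_ (Vec.∷-injectiveˡ eq) (pred-injective j es ds p q (Vec.∷-injectiveʳ eq))

  divide-distinct : ∀ {n} (j : Fin n) {ms : List (Monomial n)} → All (j ∣ᵐ_) ms →
                    AllPairs (_≢_ on exponents) ms →
                    AllPairs (_≢_ on (exponents ∘ divideMonomial j)) ms
  divide-distinct j []       []       = []
  divide-distinct j (d ∷ ds) (x ∷ xs) =
    All.zipWith (λ (d′ , m≢m′) eq → m≢m′ (pred-injective j _ _ d d′ eq)) (ds , x)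
    ∷ divide-distinct j ds xs

-- The q′ with q = xⱼ · q′.
quotient : ∀ {n} (q : Polynomial n) (j : Fin n) → All (j ∣ᵐ_) (monomials q) → Polynomial n
quotient q j j∣q = record
  { monomials = map (divideMonomial j) (monomials q)
  ; distinct  = AllPairs.map⁺ (divide-distinct j j∣q (distinct q))
  }

-- p_{xⱼ}↓
reduction : ∀ {n} → VariableOrder n → Polynomial n → Fin n → Polynomial n
reduction o p j = quotient (group o p j) j (group-divisible o p j)

degree : ∀ {n} → Polynomial n → ℕ
degree p = max 0 (map (Vec.sum ∘ exponents) (monomials p))

private
  sum-pred : ∀ {n} (j : Fin n) (es : Vec ℕ n) → 1 ≤ lookup es j →
             Vec.sum (updateAt es j pred) < Vec.sum es
  sum-pred zero    (suc e ∷ es) _ = ℕ.n<1+n _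
  sum-pred (suc j) (e ∷ es)     d = ℕ.+-monoʳ-< e (sum-pred j es d)

  sum≡0 : ∀ {n} (es : Vec ℕ n) → Vec.sum es ≡ 0 → es ≡ Vec.replicate n 0
  sum≡0 []          _  = refl
  sum≡0 (zero ∷ es) eq = cong (0 ∷_) (sum≡0 es eq)

  degrees≤ : ∀ {n} (p : Polynomial n) →
             All (λ m → Vec.sum (exponents m) ≤ degree p) (monomials p)
  degrees≤ p = All.map⁻ (xs≤max 0 (map (Vec.sum ∘ exponents) (monomials p)))

  0<degree : ∀ {n} (p : Polynomial n) → ¬ Constant p → 0 < degree p
  0<degree p nc = ℕ.n≢0⇒n>0 λ eq → nc
    (All.map (λ {m} le → sum≡0 (exponents m) (ℕ.n≤0⇒n≡0 (ℕ.≤-trans le (ℕ.≤-reflexive eq))))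
             (degrees≤ p))

reduction-degree : ∀ {n} (o : VariableOrder n) (p : Polynomial n) (j : Fin n) → ¬ Constant p →
                   degree (reduction o p j) < degree p
reduction-degree o p j nc = max<v⁺ (0<degree p nc) (All.map⁺ (All.map⁺
  (All.zipWith (λ {m} (d , le) → ℕ.<-≤-trans (sum-pred j (exponents m) d) le)
    (group-divisible o p j , All.filter⁺ (inGroup? o j) (degrees≤ p)))))

------------------------------------------------------------------------
-- The n-converter

-- The number of copies of a put in front: |c| if the sign of c is ⋆, else 0.
copies : Sign → ℤ → ℕ
copies Sign.+ (+ c)    = c
copies Sign.+ -[1+ c ] = 0
copies Sign.- (+ c)    = 0
copies Sign.- -[1+ c ] = suc c

module _ (S : Signature) {n : ℕ} (order : Polynomial n → VariableOrder n) where
  open Signature S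

  aᵗ : Term (WithF Sym n) ⊥
  aᵗ = app (sym a) []

  -- g(aᵏ,u), which is u for k = 0.
  prefix : ℕ → Term (WithF Sym n) ⊥ → Term (WithF Sym n) ⊥
  prefix k u = flat (sym g) (replicate k aᵗ ∷ʳ u)

  cvtAcc : Sign → (p : Polynomial n) → Acc _<_ (degree p) → Term (WithF Sym n) ⊥
  cvtAcc ⋆ p (acc rs) with constant? p
  ... | yes _ = prefix (copies ⋆ (constantTerm p)) aᵗ
  ... | no nc = prefix (copies ⋆ (constantTerm p))
                  (app F (tabulate λ i → cvtAcc ⋆ (reduction (order p) p i)
                                                 (rs (reduction-degree (order p) p i nc))))

  cvt : Sign → Polynomial n → Term (WithF Sym n) ⊥
  cvt ⋆ p = cvtAcc ⋆ p (<-wellFounded (degree p))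

  inducedProblem : Polynomial n → Problem S n
  inducedProblem p = record
    { equations = [ cvt Sign.+ p , cvt Sign.- p ]
    ; theory    = 𝒜 S
    }

{-# OPTIONS --safe #-}
module Submission where

-- Associativity preserves the number of leaves of a term, and under σ the
-- number of leaves of cvt[F,p]⁺ exceeds that of cvt[F,p]⁻ by exactly p(h).
-- Conversely, leaf counts decide the equation: under σ both sides are
-- g(aᵏ,w) for one and the same w.  Here w is a if p is constant or some hᵢ is
-- positive, and otherwise w is the ground body e.

open import Defs
open import Data.Empty using (⊥; ⊥-elim)
open import Data.Integer.Base using (0ℤ)
open import Data.Nat.Base using (ℕ; NonZero)
open import Data.Vec.Base using (Vec)
open import Function.Bundles using (_⇔_)
open import Relation.Binary.PropositionalEquality using (_≡_)

open import Data.Fin.Base using (Fin; zero; suc)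
open import Data.Fin.Induction using (spo-wellFounded)
open import Data.Fin.Properties using (any?; suc-injective)
open import Data.Integer.Base using (ℤ; +_; -[1+_]; 1ℤ; _+_; _*_)
import Data.Integer.Properties as ℤ
open import Data.Integer.Tactic.RingSolver using (solve-∀)
open import Data.List.Base as List using (List; []; _∷_; _++_)
import Data.List.NonEmpty.Base as List⁺
import Data.List.Properties as List
open import Data.List.Relation.Unary.All as All using (All; []; _∷_)
import Data.List.Relation.Unary.All.Properties as All
open import Data.List.Relation.Unary.Any using (here)
open import Data.Maybe.Base using (maybe′)
open import Data.Nat.Base as ℕ using (zero; suc; pred; _≤_; _<_)
import Data.Nat.Induction as ℕ
import Data.Nat.Properties as ℕ
import Data.Nat.Tactic.RingSolver as ℕ
open import Data.Product.Base using (∃; _,_; proj₁; proj₂)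
open import Data.Sign.Base as Sign using (Sign)
open import Data.Sum.Base using (_⊎_; inj₁; inj₂)
open import Data.Vec.Base as Vec using ([]; _∷_; lookup; tabulate)
import Data.Vec.Properties as Vec
open import Data.Vec.Relation.Binary.Pointwise.Inductive using (Pointwise; []; _∷_)
open import Function.Base using (_∘_; id)
open import Function.Bundles using (mk⇔)
open import Induction.WellFounded using (Acc; acc)
open import Relation.Binary.Definitions using (tri<; tri≈; tri>)
import Relation.Binary.PropositionalEquality as ≡
open import Relation.Binary.PropositionalEquality using (refl; cong; cong₂; _≢_; module ≡-Reasoning)
open import Relation.Binary.Structures using (IsStrictTotalOrder)
open import Relation.Unary using (Decidable)
open import Relation.Nullary using (¬_; Dec; yes; no; contradiction; _×-dec_)

open import Algebra.Properties.AbelianGroup ℤ.+-0-abelianGroup using () renaming (∙-cancelʳ to +-cancelʳ)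
open import Algebra.Properties.Semiring.Sum ℤ.+-*-semiring
  using (sum; sum-cong-≗; ∑-distrib-+; sum-replicate-zero; sum-syntax)

open ≡-Reasoning

-- Integer sums over finite index sets and lists.

∑-zero : ∀ {n} {f : Fin n → ℤ} → (∀ i → f i ≡ 0ℤ) → sum f ≡ 0ℤ
∑-zero {n} f≡0 = ≡.trans (sum-cong-≗ f≡0) (sum-replicate-zero n)

∑-single : ∀ {n} (f : Fin n → ℤ) i → (∀ j → j ≢ i → f j ≡ 0ℤ) → sum f ≡ f i
∑-single f zero f≡0 =
  ≡.trans (cong (_+_ (f zero)) (∑-zero λ j → f≡0 (suc j) λ ())) (ℤ.+-identityʳ _)
∑-single f (suc i) f≡0 = ≡.trans
  (cong₂ _+_ (f≡0 zero λ ()) (∑-single (f ∘ suc) i λ j j≢i → f≡0 (suc j) (j≢i ∘ suc-injective)))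
  (ℤ.+-identityˡ _)

sumℤ-++ : ∀ xs ys → sumℤ (xs ++ ys) ≡ sumℤ xs + sumℤ ys
sumℤ-++ []       ys = ≡.sym (ℤ.+-identityˡ _)
sumℤ-++ (x ∷ xs) ys = ≡.trans (cong (_+_ x) (sumℤ-++ xs ys)) (≡.sym (ℤ.+-assoc x _ _))

sumℤ-filter-∷ : ∀ {A : Set} {P : A → Set} (P? : Decidable P) (f : A → ℤ) x xs →
  sumℤ (List.map f (List.filter P? (x ∷ xs)))
    ≡ sumℤ (List.map f (List.filter P? (x ∷ []))) + sumℤ (List.map f (List.filter P? xs))
sumℤ-filter-∷ P? f x xs = begin
  sumℤ (List.map f (List.filter P? (x ∷ xs)))
    ≡⟨ cong (sumℤ ∘ List.map f) (List.filter-++ P? (x ∷ []) xs) ⟩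
  sumℤ (List.map f (List.filter P? (x ∷ []) ++ List.filter P? xs))
    ≡⟨ cong sumℤ (List.map-++ f (List.filter P? (x ∷ [])) _) ⟩
  sumℤ (List.map f (List.filter P? (x ∷ [])) ++ List.map f (List.filter P? xs))
    ≡⟨ sumℤ-++ (List.map f (List.filter P? (x ∷ []))) _ ⟩
  _ ∎

sumℤ-replicate : ∀ k x → sumℤ (List.replicate k x) ≡ + k * x
sumℤ-replicate zero    x = ≡.sym (ℤ.*-zeroˡ x)
sumℤ-replicate (suc k) x = ≡.trans (cong (_+_ x) (sumℤ-replicate k x)) (≡.sym (ℤ.suc-* (+ k) x))

-- The enumeration `t` is arbitrary so that the induction on `n` can pass to `t ∘ suc`; the use
-- below is `t = id`, where the list is `allFin n`.
sumℤ-concatMap-replicate : ∀ {A B : Set} {n} (f : A → ℤ) (k : B → ℕ) (v : B → A) (t : Fin n → B) →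
  sumℤ (List.map f (List.concatMap (λ b → List.replicate (k b) (v b)) (List.tabulate t)))
    ≡ ∑[ i < n ] (+ k (t i) * f (v (t i)))
sumℤ-concatMap-replicate {n = zero}  f k v t = refl
sumℤ-concatMap-replicate {n = suc n} f k v t = begin
  sumℤ (List.map f (List.replicate (k b) (v b) ++ rest))
    ≡⟨ cong sumℤ (List.map-++ f (List.replicate (k b) (v b)) rest) ⟩
  sumℤ (List.map f (List.replicate (k b) (v b)) ++ List.map f rest)
    ≡⟨ sumℤ-++ (List.map f (List.replicate (k b) (v b))) _ ⟩
  sumℤ (List.map f (List.replicate (k b) (v b))) + sumℤ (List.map f rest)
    ≡⟨ cong₂ _+_ (≡.trans (cong sumℤ (List.map-replicate f (k b) (v b))) (sumℤ-replicate (k b) _))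
                 (sumℤ-concatMap-replicate f k v (t ∘ suc)) ⟩
  _ ∎
  where
  b    = t zero
  rest = List.concatMap (λ b → List.replicate (k b) (v b)) (List.tabulate (t ∘ suc))

-- Decomposing a polynomial along its monomial groupings

module _ {n : ℕ} (h : Vec ℕ n) where

  value-constant : ∀ m → IsConstant m → value h m ≡ coeff m
  value-constant m const = ≡.trans
    (cong (λ es → coeff m * + Vec.foldr _ ℕ._*_ 1 (Vec.zipWith ℕ._^_ h es)) const)
    (≡.trans (cong (λ x → coeff m * + x) (power-zero h)) (ℤ.*-identityʳ (coeff m)))
    where
    power-zero : ∀ {n} (h : Vec ℕ n) →
                 Vec.foldr _ ℕ._*_ 1 (Vec.zipWith ℕ._^_ h (Vec.replicate n 0)) ≡ 1
    power-zero []      = refl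
    power-zero (x ∷ h) = ≡.trans (ℕ.+-identityʳ _) (power-zero h)

  value-divide : ∀ j m → j ∣ᵐ m → value h m ≡ + lookup h j * value h (divideMonomial j m)
  value-divide j m j∣m = begin
    coeff m * + _                                 ≡⟨ cong (λ x → coeff m * + x) (power-pred j h (exponents m) j∣m) ⟩
    coeff m * + (lookup h j ℕ.* rest)             ≡⟨ cong (coeff m *_) (ℤ.pos-* (lookup h j) rest) ⟩
    coeff m * (+ lookup h j * + rest)             ≡⟨ swap (coeff m) (+ lookup h j) (+ rest) ⟩
    + lookup h j * (coeff m * + rest)             ∎
    where
    rest = Vec.foldr _ ℕ._*_ 1 (Vec.zipWith ℕ._^_ h (exponents (divideMonomial j m)))
    swap : ∀ x y z → x * (y * z) ≡ y * (x * z)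
    swap = solve-∀
    ℕ-swap : ∀ x y z → x ℕ.* (y ℕ.* z) ≡ y ℕ.* (x ℕ.* z)
    ℕ-swap = ℕ.solve-∀
    power-pred : ∀ {n} (j : Fin n) (h es : Vec ℕ n) → 1 ≤ lookup es j →
                 Vec.foldr _ ℕ._*_ 1 (Vec.zipWith ℕ._^_ h es) ≡
                 lookup h j ℕ.* Vec.foldr _ ℕ._*_ 1 (Vec.zipWith ℕ._^_ h (Vec.updateAt es j pred))
    power-pred zero    (x ∷ h) (suc d ∷ es) _ = ℕ.*-assoc x _ _
    power-pred (suc j) (x ∷ h) (d ∷ es)     p = ≡.trans
      (cong (x ℕ.^ d ℕ.*_) (power-pred j h es p))
      (ℕ-swap (x ℕ.^ d) (lookup h j) _)

  value-quotient : ∀ q j (j∣q : All (j ∣ᵐ_) (monomials q)) →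
                   ⟦ q ⟧ h ≡ + lookup h j * ⟦ quotient q j j∣q ⟧ h
  value-quotient q j = go (monomials q)
    where
    go : ∀ ms → All (j ∣ᵐ_) ms →
         sumℤ (List.map (value h) ms) ≡
         + lookup h j * sumℤ (List.map (value h) (List.map (divideMonomial j) ms))
    go []       []           = ≡.sym (ℤ.*-zeroʳ (+ lookup h j))
    go (m ∷ ms) (j∣m ∷ j∣ms) = ≡.trans (cong₂ _+_ (value-divide j m j∣m) (go ms j∣ms))
                                       (≡.sym (ℤ.*-distribˡ-+ (+ lookup h j) _ _))

  constant-value : ∀ p → Constant p → ⟦ p ⟧ h ≡ constantTerm p
  constant-value p const = ≡.trans
    (go const)
    (cong (sumℤ ∘ List.map coeff) (≡.sym (List.filter-all isConstant? const)))
    where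
    go : ∀ {ms} → All IsConstant ms → sumℤ (List.map (value h) ms) ≡ sumℤ (List.map coeff ms)
    go []               = refl
    go {m ∷ _} (c ∷ cs) = cong₂ _+_ (value-constant m c) (go cs)

  module _ (o : VariableOrder n) where
    open VariableOrder o
    open IsStrictTotalOrder isStrictTotalOrder using (isStrictPartialOrder; compare)

    divisor : ∀ (m : Monomial n) → ¬ IsConstant m → ∃ (_∣ᵐ m)
    divisor m nc with any? (_∣ᵐ? m)
    ... | yes div = div
    -- If no variable divides `m`, every exponent is 0, so `m` would be constant.
    ... | no ¬div = contradiction
      (≡.trans (≡.sym (Vec.tabulate∘lookup (exponents m)))
        (≡.trans (Vec.tabulate-cong λ i → ≡.trans (ℕ.n<1⇒n≡0 (ℕ.≰⇒> λ i∣m → ¬div (i , i∣m)))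
                                                  (≡.sym (Vec.lookup-replicate i 0)))
          (Vec.tabulate∘lookup (Vec.replicate n 0)))) nc

    -- Groups cover the nonconstant monomials: starting from any divisor, descend along `≺` to a
    -- smaller one while possible. The descent stops because a strict order on a finite set is
    -- well-founded.
    leastDivisor : ∀ m j → j ∣ᵐ m → ∃ λ i → InGroup o i m
    leastDivisor m j = go j (spo-wellFounded isStrictPartialOrder j)
      where
      go : ∀ j → Acc _≺_ j → j ∣ᵐ m → ∃ λ i → InGroup o i m
      go j (acc rs) j∣m with any? (λ i → (i ≺? j) ×-dec (i ∣ᵐ? m))
      ... | yes (i , i≺j , i∣m) = go i (rs i≺j) i∣m
      ... | no none             = j , j∣m , λ i i≺j i∣m → none (i , i≺j , i∣m)

    -- Groups are disjoint: of two distinct candidates the smaller one divides `m`, which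
    -- contradicts the minimality of the larger one.
    inGroup-unique : ∀ {i j} m → InGroup o i m → InGroup o j m → i ≡ j
    inGroup-unique {i} {j} m (i∣m , i-least) (j∣m , j-least) with compare i j
    ... | tri< i≺j _ _ = contradiction i∣m (j-least i i≺j)
    ... | tri≈ _ i≡j _ = i≡j
    ... | tri> _ _ j≺i = contradiction j∣m (i-least j j≺i)

    inGroup⇒¬constant : ∀ {i} m → InGroup o i m → ¬ IsConstant m
    inGroup⇒¬constant {i} m (i∣m , _) const = contradiction
      (≡.trans (cong (λ es → lookup es i) const) (Vec.lookup-replicate i 0)) (ℕ.m<n⇒n≢0 i∣m)

    groupValue : Fin n → List (Monomial n) → ℤ
    groupValue i ms = sumℤ (List.map (value h) (List.filter (inGroup? o i) ms))

    constantValue : List (Monomial n) → ℤ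
    constantValue ms = sumℤ (List.map coeff (List.filter isConstant? ms))

    groupValue-∈ : ∀ {i} m → InGroup o i m → groupValue i (m ∷ []) ≡ value h m
    groupValue-∈ m i∋m = ≡.trans
      (cong (sumℤ ∘ List.map (value h)) (List.filter-accept (inGroup? o _) {m} {[]} i∋m)) (ℤ.+-identityʳ _)

    groupValue-∉ : ∀ {i} m → ¬ InGroup o i m → groupValue i (m ∷ []) ≡ 0ℤ
    groupValue-∉ m i∌m = cong (sumℤ ∘ List.map (value h)) (List.filter-reject (inGroup? o _) {m} {[]} i∌m)

    constantValue-constant : ∀ m → IsConstant m → constantValue (m ∷ []) ≡ coeff m
    constantValue-constant m c = ≡.trans
      (cong (sumℤ ∘ List.map coeff) (List.filter-accept isConstant? {m} {[]} c)) (ℤ.+-identityʳ _)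

    constantValue-nonconstant : ∀ m → ¬ IsConstant m → constantValue (m ∷ []) ≡ 0ℤ
    constantValue-nonconstant m nc = cong (sumℤ ∘ List.map coeff) (List.filter-reject isConstant? {m} {[]} nc)

    -- A constant monomial lies in no group and is counted by the constant term only; any other
    -- monomial lies in exactly one group, so the sum over groups has a single nonzero candidate.
    monomial-decomposition : ∀ m →
      value h m ≡ constantValue (m ∷ []) + ∑[ i < n ] groupValue i (m ∷ [])
    monomial-decomposition m = go (isConstant? m)
      where
      go : Dec (IsConstant m) → value h m ≡ constantValue (m ∷ []) + ∑[ i < n ] groupValue i (m ∷ [])
      go (yes const) = begin
        value h m      ≡⟨ value-constant m const ⟩
        coeff m        ≡⟨ ℤ.+-identityʳ _ ⟨
        coeff m + 0ℤ   ≡⟨ cong₂ _+_ (constantValue-constant m const)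
                            (∑-zero {n} λ i → groupValue-∉ m λ i∋m → inGroup⇒¬constant m i∋m const) ⟨
        _              ∎
      go (no nc) with leastDivisor m _ (proj₂ (divisor m nc))
      ... | i , i∋m = begin
        value h m                    ≡⟨ groupValue-∈ m i∋m ⟨
        groupValue i (m ∷ [])        ≡⟨ ∑-single (λ j → groupValue j (m ∷ [])) i
                                          (λ j j≢i → groupValue-∉ m λ j∋m → j≢i (inGroup-unique m j∋m i∋m)) ⟨
        ∑[ j < n ] groupValue j (m ∷ [])         ≡⟨ ℤ.+-identityˡ _ ⟨
        0ℤ + ∑[ j < n ] groupValue j (m ∷ [])    ≡⟨ cong (_+ (∑[ j < n ] groupValue j (m ∷ []))) (constantValue-nonconstant m nc) ⟨
        _                            ∎

    -- Both sides are additive in the list of monomials, which leaves the case of one monomial.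
    decomposition : ∀ ms →
      sumℤ (List.map (value h) ms) ≡ constantValue ms + ∑[ i < n ] groupValue i ms
    decomposition []       = ≡.sym (≡.trans (ℤ.+-identityˡ _) (∑-zero {n} λ _ → refl))
    decomposition (m ∷ ms) = begin
      value h m + sumℤ (List.map (value h) ms)
        ≡⟨ cong₂ _+_ (monomial-decomposition m) (decomposition ms) ⟩
      (constantValue (m ∷ []) + ∑[ i < n ] groupValue i (m ∷ []))
        + (constantValue ms + ∑[ i < n ] groupValue i ms)
        ≡⟨ interchange (constantValue (m ∷ [])) _ _ _ ⟩
      (constantValue (m ∷ []) + constantValue ms)
        + (∑[ i < n ] groupValue i (m ∷ []) + ∑[ i < n ] groupValue i ms)
        ≡⟨ cong₂ _+_ (sumℤ-filter-∷ isConstant? coeff m ms)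
             (≡.trans (sum-cong-≗ λ i → sumℤ-filter-∷ (inGroup? o i) (value h) m ms) (∑-distrib-+ (λ i → groupValue i (m ∷ [])) _)) ⟨
      constantValue (m ∷ ms) + ∑[ i < n ] groupValue i (m ∷ ms) ∎
      where
      interchange : ∀ x y z w → (x + y) + (z + w) ≡ (x + z) + (y + w)
      interchange = solve-∀

    -- This is the identity that the recursion of the converter follows: the prefix of copies of a
    -- encodes the constant term, the i-th argument of F encodes the i-th reduction, and σ
    -- multiplies that argument by hᵢ.
    value-reductions : ∀ p →
      ⟦ p ⟧ h ≡ constantTerm p + ∑[ i < n ] (+ lookup h i * ⟦ reduction o p i ⟧ h)
    value-reductions p = ≡.trans (decomposition (monomials p))
      (cong (_+_ (constantTerm p)) (sum-cong-≗ λ i → value-quotient (group o p i) i (group-divisible o p i)))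

-- An integer is its positive part minus its negative part; the two parts are the prefixes on the
-- two sides of the equation.
copies-difference : ∀ c → + copies Sign.+ c ≡ c + + copies Sign.- c
copies-difference (+ c)    = ≡.sym (ℤ.+-identityʳ (+ c))
copies-difference -[1+ c ] = ≡.sym (ℤ.+-inverseˡ (+ suc c))

-- Counting leaves

module _ {Op : ℕ → Set} where

  mutual
    -- Every nullary symbol weighs 1, not only a, and a variable weighs `w x`, so that counting
    -- after a substitution is counting with other weights. The values lie in ℤ because they are
    -- compared with values of p, which may be negative.
    leaves : ∀ {X} → (X → ℤ) → Term Op X → ℤ
    leaves w (var x)          = w x
    leaves w (app f [])       = 1ℤ
    leaves w (app f (u ∷ us)) = leaves w u + leaves* w us

    leaves* : ∀ {X k} → (X → ℤ) → Vec (Term Op X) k → ℤ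
    leaves* w []       = 0ℤ
    leaves* w (u ∷ us) = leaves w u + leaves* w us

  ∣_∣ : Term Op ⊥ → ℤ
  ∣_∣ = leaves ⊥-elim

  mutual
    leaves-subst : ∀ {X Y} (w : Y → ℤ) (θ : X → Term Op Y) t →
                   leaves w (subst θ t) ≡ leaves (leaves w ∘ θ) t
    leaves-subst w θ (var x)          = refl
    leaves-subst w θ (app f [])       = refl
    leaves-subst w θ (app f (u ∷ us)) = cong₂ _+_ (leaves-subst w θ u) (leaves*-subst w θ us)

    leaves*-subst : ∀ {X Y k} (w : Y → ℤ) (θ : X → Term Op Y) (us : Vec _ k) →
                    leaves* w (substs θ us) ≡ leaves* (leaves w ∘ θ) us
    leaves*-subst w θ []       = refl
    leaves*-subst w θ (u ∷ us) = cong₂ _+_ (leaves-subst w θ u) (leaves*-subst w θ us)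

  mutual
    leaves-cong : ∀ {X} {w w′ : X → ℤ} → (∀ x → w x ≡ w′ x) → ∀ t → leaves w t ≡ leaves w′ t
    leaves-cong eq (var x)          = eq x
    leaves-cong eq (app f [])       = refl
    leaves-cong eq (app f (u ∷ us)) = cong₂ _+_ (leaves-cong eq u) (leaves*-cong eq us)

    leaves*-cong : ∀ {X k} {w w′ : X → ℤ} → (∀ x → w x ≡ w′ x) → (us : Vec _ k) →
                   leaves* w us ≡ leaves* w′ us
    leaves*-cong eq []       = refl
    leaves*-cong eq (u ∷ us) = cong₂ _+_ (leaves-cong eq u) (leaves*-cong eq us)

  mutual
    subst-ground : ∀ {X} (θ : X → Term Op ⊥) (ρ : ⊥ → Term Op X) t → subst θ (subst ρ t) ≡ t
    subst-ground θ ρ (app f us) = cong (app f) (substs-ground θ ρ us)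

    substs-ground : ∀ {X k} (θ : X → Term Op ⊥) (ρ : ⊥ → Term Op X) (us : Vec _ k) →
                    substs θ (substs ρ us) ≡ us
    substs-ground θ ρ []       = refl
    substs-ground θ ρ (u ∷ us) = cong₂ _∷_ (subst-ground θ ρ u) (substs-ground θ ρ us)

  leaves-flat : ∀ {X} (g : Op 2) (w : X → ℤ) u us →
                leaves w (flat g (u List⁺.∷ us)) ≡ sumℤ (List.map (leaves w) (u ∷ us))
  leaves-flat g w u []       = ≡.sym (ℤ.+-identityʳ _)
  leaves-flat g w u (v ∷ us) =
    cong (_+_ (leaves w u)) (≡.trans (ℤ.+-identityʳ _) (leaves-flat g w v us))

module _ (S : Signature) where
  open Signature S

  mutual
    leaves-≈ : ∀ {X} (w : X → ℤ) {u v} → 𝒜 S ⊢ u ≈ v → leaves w u ≡ leaves w v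
    leaves-≈ w (ax (here refl) θ) = assoc (leaves w (θ 0)) (leaves w (θ 1)) (leaves w (θ 2))
      where
      -- Each `0ℤ` is the count of the empty tail of an argument vector.
      assoc : ∀ x y z → x + ((y + (z + 0ℤ)) + 0ℤ) ≡ (x + (y + 0ℤ)) + (z + 0ℤ)
      assoc = solve-∀
    leaves-≈ w ≈-refl              = refl
    leaves-≈ w (≈-sym p)           = ≡.sym (leaves-≈ w p)
    leaves-≈ w (≈-trans p q)       = ≡.trans (leaves-≈ w p) (leaves-≈ w q)
    leaves-≈ w (≈-cong f [])       = refl
    leaves-≈ w (≈-cong f (p ∷ ps)) = cong₂ _+_ (leaves-≈ w p) (leaves*-≈ w ps)

    leaves*-≈ : ∀ {X k} (w : X → ℤ) {us vs : Vec _ k} → Pointwise (𝒜 S ⊢_≈_) us vs →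
                leaves* w us ≡ leaves* w vs
    leaves*-≈ w []       = refl
    leaves*-≈ w (p ∷ ps) = cong₂ _+_ (leaves-≈ w p) (leaves*-≈ w ps)

  -- Powers of a modulo associativity.

  infix 4 _≈_
  _≈_ : Term Sym ⊥ → Term Sym ⊥ → Set
  u ≈ v = 𝒜 S ⊢ u ≈ v

  a₀ : Term Sym ⊥
  a₀ = app a []

  infixr 6 _·_
  _·_ : Term Sym ⊥ → Term Sym ⊥ → Term Sym ⊥
  u · v = app g (u ∷ v ∷ [])

  ·-cong : ∀ {u u′ v v′} → u ≈ u′ → v ≈ v′ → u · v ≈ u′ · v′
  ·-cong p q = ≈-cong g (p ∷ q ∷ [])

  ·-assoc : ∀ u v w → u · v · w ≈ (u · v) · w
  -- The variables of the axiom are 0, 1 and 2; the last clause serves 2 and the indices that do not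
  -- occur.
  ·-assoc u v w = ax (here refl) λ { 0 → u ; 1 → v ; _ → w }

  -- This is g(aᵏ,u). The base `u` stays a parameter because it may be the ground body `e`. With
  -- base `a₀` the exponent is one less than the number of copies of a.
  _a^_ : Term Sym ⊥ → ℕ → Term Sym ⊥
  u a^ zero  = u
  u a^ suc k = a₀ · (u a^ k)

  a^-cong : ∀ k {u v} → u ≈ v → u a^ k ≈ v a^ k
  a^-cong zero    p = p
  a^-cong (suc k) p = ·-cong ≈-refl (a^-cong k p)

  a^-+ : ∀ k m u → (u a^ m) a^ k ≡ u a^ (k ℕ.+ m)
  a^-+ zero    m u = refl
  a^-+ (suc k) m u = cong (a₀ ·_) (a^-+ k m u)

  a^-leaves : ∀ k u → ∣ u a^ k ∣ ≡ + k + ∣ u ∣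
  a^-leaves zero    u = ≡.sym (ℤ.+-identityˡ _)
  a^-leaves (suc k) u = begin
    1ℤ + (∣ u a^ k ∣ + 0ℤ)   ≡⟨ cong (_+_ 1ℤ) (≡.trans (ℤ.+-identityʳ _) (a^-leaves k u)) ⟩
    1ℤ + (+ k + ∣ u ∣)       ≡⟨ ℤ.+-assoc 1ℤ (+ k) ∣ u ∣ ⟨
    + suc k + ∣ u ∣          ∎

  IsPower : Term Sym ⊥ → Set
  IsPower u = ∃ λ k → u ≈ a₀ a^ k

  a^-isPower : ∀ k {u} → IsPower u → IsPower (u a^ k)
  a^-isPower k (m , p) = k ℕ.+ m , ≡.subst (_ ≈_) (a^-+ k m a₀) (a^-cong k p)

  -- The additional `suc` is the copy of a that serves as base of the left factor.
  powers-· : ∀ k m → a₀ a^ k · a₀ a^ m ≈ a₀ a^ (suc k ℕ.+ m)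
  powers-· zero    m = ≈-refl
  powers-· (suc k) m = ≈-trans (≈-sym (·-assoc a₀ _ _)) (·-cong ≈-refl (powers-· k m))

  ·-isPower : ∀ {u v} → IsPower u → IsPower v → IsPower (u · v)
  ·-isPower (k , p) (m , q) = suc k ℕ.+ m , ≈-trans (·-cong p q) (powers-· k m)

  -- The body that σ assigns to F.

  module _ {n : ℕ} (e : Term Sym ⊥) (h : Vec ℕ n) where

    private
      occurrences : List (Term Sym (Fin n))
      occurrences = List.concatMap (λ i → List.replicate (lookup h i) (var i)) (List.allFin n)

      ground : Term Sym (Fin n)
      ground = subst (λ ()) e

      -- `r` is `body occurrences`. Abstracting the list permits a case split on its being empty,
      -- that is, on all hᵢ being zero.
      body : List (Term Sym (Fin n)) → Term Sym (Fin n)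
      body us = maybe′ (flat g) ground (List⁺.fromList us)

      r = repeatBody S e h

    -- The body acts on leaf counts as an affine map with coefficients hᵢ. Its offset `b` is the
    -- leaf count of `e` if the list of occurrences is empty and 0 otherwise; it is chosen before
    -- `w`, hence is common to both sides of the equation and cancels.
    repeatBody-leaves : ∃ λ b → ∀ w →
      leaves w r ≡ ∑[ i < n ] (+ lookup h i * w i) + b
    repeatBody-leaves with go occurrences
      where
      go : ∀ us → ∃ λ b → ∀ w → leaves w (body us) ≡ sumℤ (List.map (leaves w) us) + b
      go []       = ∣ e ∣ , λ w → ≡.trans (leaves-subst w (λ ()) e)
                      (≡.trans (leaves-cong (λ ()) e) (≡.sym (ℤ.+-identityˡ _)))
      go (u ∷ us) = 0ℤ , λ w → ≡.trans (leaves-flat g w u us) (≡.sym (ℤ.+-identityʳ _))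
    ... | b , eq = b , λ w → ≡.trans (eq w)
      (cong (_+ b) (sumℤ-concatMap-replicate (leaves w) (lookup h) var id))

    PowerPreserving : Term Sym (Fin n) → Set
    PowerPreserving t = ∀ θ → (∀ i → IsPower (θ i)) → IsPower (subst θ t)

    -- The dichotomy on h: with no occurrences the body is the ground term `e`, which may be no
    -- power of a; otherwise it is a product of variables, and powers are closed under products.
    repeatBody-subst : (∀ θ → subst θ r ≡ e) ⊎ PowerPreserving r
    repeatBody-subst = go occurrences (All.concat⁺ (All.map⁺ (All.universal
      (λ i → All.replicate⁺ (lookup h i) λ θ powers → powers i) (List.allFin n))))
      where
      flat-powerPreserving : ∀ {u us} → PowerPreserving u → All PowerPreserving us →
                             PowerPreserving (flat g (u List⁺.∷ us))
      flat-powerPreserving p []       = p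
      flat-powerPreserving p (q ∷ qs) θ powers =
        ·-isPower (p θ powers) (flat-powerPreserving q qs θ powers)
      go : ∀ us → All PowerPreserving us →
           (∀ θ → subst θ (body us) ≡ e) ⊎ PowerPreserving (body us)
      go []       _        = inj₁ λ θ → subst-ground θ (λ ()) e
      go (u ∷ us) (p ∷ ps) = inj₂ (flat-powerPreserving p ps)

    -- The converter under σ.

    module _ (order : Polynomial n → VariableOrder n) where

      private
        infix 25 _σ
        _σ : Term (WithF Sym n) ⊥ → Term Sym ⊥
        _σ = _[F≔] {S} r

        cvtᵃ : Sign → (p : Polynomial n) → Acc _<_ (degree p) → Term (WithF Sym n) ⊥
        cvtᵃ = cvtAcc S order

      lookup-σ : ∀ {k} (t : Fin k → Term (WithF Sym n) ⊥) i →
                 lookup (_[F≔]* {S} r (tabulate t)) i ≡ t i σ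
      lookup-σ t zero    = refl
      lookup-σ t (suc i) = lookup-σ (t ∘ suc) i

      prefix-σ : ∀ k u → prefix S order k u σ ≡ u σ a^ k
      prefix-σ zero          u = refl
      prefix-σ (suc zero)    u = refl
      prefix-σ (suc (suc k)) u = cong (a₀ ·_) (prefix-σ (suc k) u)

      prefix-σ-leaves : ∀ k u → ∣ prefix S order k u σ ∣ ≡ + k + ∣ u σ ∣
      prefix-σ-leaves k u = ≡.trans (cong ∣_∣ (prefix-σ k u)) (a^-leaves k (u σ))

      F-leaves : ∃ λ b → ∀ t →
        ∣ app F (tabulate t) σ ∣ ≡ ∑[ i < n ] (+ lookup h i * ∣ t i σ ∣) + b
      F-leaves with repeatBody-leaves
      ... | b , eq = b , λ t → ≡.trans (leaves-subst ⊥-elim (lookup (_[F≔]* {S} r (tabulate t))) r)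
        (≡.trans (leaves-cong (cong ∣_∣ ∘ lookup-σ t) r) (eq (λ i → ∣ t i σ ∣)))

      -- Induction along `wf`, that is, on the degree. The prefixes of the two sides differ by the
      -- constant term, the i-th arguments by the value of the i-th reduction, which σ multiplies by
      -- hᵢ, and the offset of the body is the same on both sides. By `value-reductions` these
      -- differences add up to the value of p.
      cvtAcc-leaves : ∀ p wf → ∣ cvtᵃ Sign.+ p wf σ ∣ ≡ ⟦ p ⟧ h + ∣ cvtᵃ Sign.- p wf σ ∣
      cvtAcc-leaves p (acc rs) with constant? p
      ... | yes const = begin
        ∣ prefix S order (copies Sign.+ c) (aᵗ S order) σ ∣
          ≡⟨ prefix-σ-leaves (copies Sign.+ c) (aᵗ S order) ⟩
        + copies Sign.+ c + 1ℤ
          ≡⟨ cong (_+ 1ℤ) (copies-difference c) ⟩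
        c + + copies Sign.- c + 1ℤ
          ≡⟨ ℤ.+-assoc c _ 1ℤ ⟩
        c + (+ copies Sign.- c + 1ℤ)
          ≡⟨ cong₂ _+_ (constant-value h p const) (prefix-σ-leaves (copies Sign.- c) (aᵗ S order)) ⟨
        ⟦ p ⟧ h + ∣ prefix S order (copies Sign.- c) (aᵗ S order) σ ∣ ∎
        where c = constantTerm p
      ... | no nc = begin
        ∣ prefix S order (copies Sign.+ c) (app F (tabulate (t Sign.+))) σ ∣
          ≡⟨ side Sign.+ ⟩
        + copies Sign.+ c + (∑[ i < n ] (+ lookup h i * ∣ t Sign.+ i σ ∣) + b)
          ≡⟨ cong₂ (λ x y → x + (y + b)) (copies-difference c) difference ⟩
        c + + copies Sign.- c + ((q + ∑[ i < n ] (+ lookup h i * ∣ t Sign.- i σ ∣)) + b)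
          ≡⟨ interchange c (+ copies Sign.- c) q _ b ⟩
        c + q + (+ copies Sign.- c + (∑[ i < n ] (+ lookup h i * ∣ t Sign.- i σ ∣) + b))
          ≡⟨ cong₂ _+_ (value-reductions h (order p) p) (side Sign.-) ⟨
        ⟦ p ⟧ h + ∣ prefix S order (copies Sign.- c) (app F (tabulate (t Sign.-))) σ ∣ ∎
        where
        c = constantTerm p
        b = proj₁ F-leaves
        red : Fin n → Polynomial n
        red = reduction (order p) p
        -- The value at `h` of the nonconstant part of `p`.
        q = ∑[ i < n ] (+ lookup h i * ⟦ red i ⟧ h)
        t : Sign → Fin n → Term (WithF Sym n) ⊥
        t ⋆ i = cvtᵃ ⋆ (red i) (rs (reduction-degree (order p) p i nc))
        side : ∀ ⋆ → ∣ prefix S order (copies ⋆ c) (app F (tabulate (t ⋆))) σ ∣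
                     ≡ + copies ⋆ c + (∑[ i < n ] (+ lookup h i * ∣ t ⋆ i σ ∣) + b)
        side ⋆ = ≡.trans (prefix-σ-leaves (copies ⋆ c) (app F (tabulate (t ⋆))))
                         (cong (_+_ (+ copies ⋆ c)) (proj₂ F-leaves (t ⋆)))
        difference : ∑[ i < n ] (+ lookup h i * ∣ t Sign.+ i σ ∣)
                     ≡ q + ∑[ i < n ] (+ lookup h i * ∣ t Sign.- i σ ∣)
        difference = ≡.trans
          (sum-cong-≗ λ i → ≡.trans (cong (_*_ (+ lookup h i)) (cvtAcc-leaves (red i) (rs (reduction-degree (order p) p i nc))))
                                    (ℤ.*-distribˡ-+ (+ lookup h i) _ _))
          (∑-distrib-+ (λ i → + lookup h i * ⟦ red i ⟧ h) _)
        interchange : ∀ c d q s b → c + d + ((q + s) + b) ≡ c + q + (d + (s + b))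
        interchange = solve-∀

      cvtAcc-isPower : PowerPreserving r → ∀ ⋆ p wf → IsPower (cvtᵃ ⋆ p wf σ)
      cvtAcc-isPower preserving ⋆ p (acc rs) with constant? p
      ... | yes _ = ≡.subst IsPower (≡.sym (prefix-σ k (aᵗ S order))) (k , ≈-refl)
        where k = copies ⋆ (constantTerm p)
      ... | no nc = ≡.subst IsPower (≡.sym (prefix-σ k (app F (tabulate t))))
        (a^-isPower k (preserving _ λ i → ≡.subst IsPower (≡.sym (lookup-σ t i))
          (cvtAcc-isPower preserving ⋆ (reduction (order p) p i)
            (rs (reduction-degree (order p) p i nc)))))
        where
        k = copies ⋆ (constantTerm p)
        t : Fin n → Term (WithF Sym n) ⊥
        t i = cvtᵃ ⋆ (reduction (order p) p i) (rs (reduction-degree (order p) p i nc))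

      -- The base `w` is chosen before the sign, so both sides of the equation share it and can
      -- differ only in the exponent.
      cvtAcc-form : ∀ p wf → ∃ λ w → ∀ ⋆ → ∃ λ k → cvtᵃ ⋆ p wf σ ≈ w a^ k
      cvtAcc-form p wf with repeatBody-subst
      ... | inj₂ preserving = a₀ , λ ⋆ → cvtAcc-isPower preserving ⋆ p wf
      cvtAcc-form p (acc rs) | inj₁ r≡e with constant? p
      -- Without F in the converter, `e` does not enter and the base is a.
      ... | yes _ = a₀ , λ ⋆ → copies ⋆ (constantTerm p) ,
        ≡.subst (_≈ a₀ a^ copies ⋆ (constantTerm p))
          (≡.sym (prefix-σ (copies ⋆ (constantTerm p)) (aᵗ S order))) ≈-refl
      ... | no nc = e , λ ⋆ → copies ⋆ (constantTerm p) ,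
        ≡.subst (_≈ e a^ copies ⋆ (constantTerm p))
          (≡.sym (≡.trans (prefix-σ (copies ⋆ (constantTerm p)) _)
                          (cong (_a^ copies ⋆ (constantTerm p)) (r≡e _)))) ≈-refl

      unifies⇒root : ∀ p wf → cvtᵃ Sign.+ p wf σ ≈ cvtᵃ Sign.- p wf σ → ⟦ p ⟧ h ≡ 0ℤ
      unifies⇒root p wf s≈t = +-cancelʳ ∣ cvtᵃ Sign.- p wf σ ∣ _ _ (begin
        ⟦ p ⟧ h + ∣ cvtᵃ Sign.- p wf σ ∣   ≡⟨ cvtAcc-leaves p wf ⟨
        ∣ cvtᵃ Sign.+ p wf σ ∣             ≡⟨ leaves-≈ ⊥-elim s≈t ⟩
        ∣ cvtᵃ Sign.- p wf σ ∣             ≡⟨ ℤ.+-identityˡ _ ⟨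
        0ℤ + ∣ cvtᵃ Sign.- p wf σ ∣        ∎)

      -- At a root the two leaf counts agree. The count of the common base cancels, so the exponents
      -- agree as well, and both sides are equivalent to the same term.
      root⇒unifies : ∀ p wf → ⟦ p ⟧ h ≡ 0ℤ → cvtᵃ Sign.+ p wf σ ≈ cvtᵃ Sign.- p wf σ
      root⇒unifies p wf root with cvtAcc-form p wf
      ... | w , form with form Sign.+ | form Sign.-
      ... | k , s≈ | m , t≈ =
        ≈-trans s≈ (≡.subst (λ l → w a^ l ≈ cvtᵃ Sign.- p wf σ) (≡.sym k≡m) (≈-sym t≈))
        where
        k≡m : k ≡ m
        k≡m = ℤ.+-injective (+-cancelʳ ∣ w ∣ _ _ (begin
          + k + ∣ w ∣                          ≡⟨ a^-leaves k w ⟨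
          ∣ w a^ k ∣                           ≡⟨ leaves-≈ ⊥-elim s≈ ⟨
          ∣ cvtᵃ Sign.+ p wf σ ∣               ≡⟨ cvtAcc-leaves p wf ⟩
          ⟦ p ⟧ h + ∣ cvtᵃ Sign.- p wf σ ∣     ≡⟨ cong (_+ ∣ cvtᵃ Sign.- p wf σ ∣) root ⟩
          0ℤ + ∣ cvtᵃ Sign.- p wf σ ∣          ≡⟨ ℤ.+-identityˡ _ ⟩
          ∣ cvtᵃ Sign.- p wf σ ∣               ≡⟨ leaves-≈ ⊥-elim t≈ ⟩
          ∣ w a^ m ∣                           ≡⟨ a^-leaves m w ⟩
          + m + ∣ w ∣                          ∎))

lemma4p11 : (S : Signature) (n : ℕ) .{{_ : NonZero n}} →
    (order : Polynomial n → VariableOrder n) (p : Polynomial n) →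
    (e : Term (Signature.Sym S) ⊥) (h : Vec ℕ n) →
    IsUnifier {S} (repeatBody S e h) (inducedProblem S order p) ⇔ (⟦ p ⟧ h ≡ 0ℤ)
lemma4p11 S n order p e h = mk⇔
  (λ { (s≈t ∷ []) → unifies⇒root S e h order p wf s≈t })
  (λ root → root⇒unifies S e h order p wf root ∷ [])
  where wf = ℕ.<-wellFounded (degree p)
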